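{- Let $q$ be a prime power, let $H$ be a normalized generalized Hadamard matrix $\mathrm{GH}(q,v/q)$ of order $v$ over the additive group of $\mathbb{F}_q$, let $K$ be a multiplicative group and $\phi:\mathbb{F}_q\to K$ an isomorphism from the additive group of $\mathbb{F}_q$ onto $K$. Then the code $C_H$ is a generalized Hadamard full propelinear code (GHFP-code) if and only if $\phi(H)$ is cocyclic over some cocycle $\psi$, with extension group $E_\psi\cong R\cong (C_H,\star)$, where $R$ is a regular subgroup of $\mathrm{PAut}(\mathcal{E}_{\phi(H)})$. That is: (a) if $(C_H,\star)$ is a GHFP-code, then there are a group $G$ of order $v$ and a cocycle $\psi:G\times G\to K$ such that $\phi(H)$ is cocyclic with cocycle $\psi$ and $E_\psi\cong R\cong(C_H,\star)$ for some regular subgroup $R$ of $\mathrm{PAut}(\mathcal{E}_{\phi(H)})$; (b) conversely, if $\phi(H)$ is cocyclic with cocycle $\psi:G\times G\to K$, then $C_H$ has a full propelinear structure $\star$ with $(C_H,\star)\cong E_\psi\cong R$ for some regular subgroup $R$ of $\mathrm{PAut}(\mathcal{E}_{\phi(H)})$.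
   Context: Generalized Hadamard matrices and codes. A $v\times v$ matrix $H=(h_{ij})$ over the additive group $\mathbb{F}_q$, $q\mid v$, is a $\mathrm{GH}(q,v/q)$ if for all $i<j$ the multiset $\{h_{ik}-h_{jk}: 1\le k\le v\}$ contains each element of $\mathbb{F}_q$ exactly $v/q$ times. It is normalized if its first row and column are zero. $F_H\subseteq\mathbb{F}_q^v$ is the set of rows of $H$, and $C_H=\bigcup_{\alpha\in\mathbb{F}_q}(F_H+\alpha\mathbf{1})$, with $\mathbf 1$ the all-one vector; $C_H$ is called a generalized Hadamard code. Full propelinear codes. For $\pi\in\mathcal{S}_n$ and $y\in\mathbb{F}_q^n$, $\pi(y)=(y_{\pi^{ -1}(1)},\dots,y_{\pi^{ -1}(n)})$. A code $C\subseteq\mathbb{F}_q^n$ with $\mathbf 0\in C$ is full propelinear if to every $x\in C$ is assigned $\pi_x\in\mathcal{S}_n$ such that, writing $x\star y=x+\pi_x(y)$: (i) $x\star C=C$ for all $x\in C$; (ii) $\pi_{x\star y}=\pi_x\circ\pi_y$ for all $x,y\in C$; (iii) $\pi_x$ fixes no coordinate if $x\notin\{\alpha\mathbf 1:\alpha\in\mathbb{F}_q\}$, and $\pi_x=\mathrm{Id}$ if $x=\alpha\mathbf 1$ for some $\alpha\in\mathbb{F}_q$. Then $(C,\star)$ is a group with identity $\mathbf 0$; $\star$ is called a full propelinear structure. A GHFP-code is a generalized Hadamard code that is full propelinear. Cocycles. A (normalized) cocycle is a map $\psi:G\times G\to K$ ($G$ a finite group) with $\psi(g,h)\psi(gh,k)=\psi(g,hk)\psi(h,k)$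 and $\psi(g,1)=\psi(1,g)=1$. Its extension group $E_\psi$ is the set $\{(u,g):u\in K,g\in G\}$ with product $(u,g)(v,h)=(uv\,\psi(g,h),gh)$. A matrix with entries in $K$ is cocyclic with cocycle $\psi$ if, under some indexing of its rows and columns by $G$, it has entry $\psi(g,h)$ in position $(g,h)$. Automorphisms. $\phi(H)=[\phi(h_{ij})]$. With $K=\{k_0=1,\dots,k_{q-1}\}$, and $M$ a matrix over $K$, $\mathcal{E}_M=[k_ik_jM]_{0\le i,j\le q-1}$ (a $q\times q$ block matrix). $\mathrm{PAut}(A)$ is the group of pairs $(P,Q)$ of permutation matrices with $PAQ^{\top}=A$, with componentwise multiplication. A subgroup of $\mathrm{PAut}(A)$ is regular if its induced actions on the rows and on the columns of $A$ are both regular. -}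

module Defs where

open import Level using (Level; _⊔_; suc; 0ℓ)
open import Data.Nat.Base using (ℕ; _^_; _*_; NonZero)
open import Data.Nat.Divisibility using (_∣_; quotient)
open import Data.Nat.Primality using (Prime)
open import Data.Fin.Base using (Fin; toℕ; remQuot; _<_)
import Data.Fin.Properties as Fin
open import Data.Fin.Permutation as Perm using (Permutation′; _⟨$⟩ʳ_; _⟨$⟩ˡ_; _∘ₚ_)
open import Data.Product.Base using (∃; ∃-syntax; _×_; _,_; proj₁; proj₂)
open import Data.Vec.Functional using (Vector)
open import Data.Vec.Base using (tabulate; count)
open import Function.Bundles using (Inverse)
open import Function.Properties.Inverse using (Inverse⇒Injection)
import Function.Construct.Symmetry as Symmetry
open import Relation.Nullary using (¬_)
open import Relation.Nullary.Decidable using (via-injection)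
open import Relation.Unary using (Pred; _∈_)
open import Relation.Binary.Core using (Rel)
open import Relation.Binary.Bundles using (Setoid)
open import Relation.Binary.Definitions using (Decidable; _Respects_)
open import Relation.Binary.PropositionalEquality as ≡ using (_≡_; _≢_)
open import Algebra.Bundles using (Group; AbelianGroup; CommutativeRing)
open import Algebra.Definitions using (Commutative)
open import Algebra.Apartness.Bundles using (HeytingField; HeytingCommutativeRing)
open import Algebra.Morphism.Structures using (IsGroupIsomorphism)
import Algebra.Properties.CommutativeSemigroup as CommutativeSemigroupProperties
import Relation.Binary.Reasoning.Setoid as SetoidReasoning

private
  variable
    a b c ℓ ℓ₁ ℓ₂ k ℓk p : Level
    m n q v : ℕ

IsPrimePower : ℕ → Set
IsPrimePower q = ∃[ p ] ∃[ r ] (Prime p × NonZero r × q ≡ p ^ r)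

HasSize : Setoid a ℓ → ℕ → Set (a ⊔ ℓ)
HasSize S n = Inverse (≡.setoid (Fin n)) S

HasOrder : Group a ℓ → ℕ → Set (a ⊔ ℓ)
HasOrder G n = HasSize (Group.setoid G) n

infix 4 _≅_

record _≅_ (G : Group a ℓ₁) (H : Group b ℓ₂) : Set (a ⊔ b ⊔ ℓ₁ ⊔ ℓ₂) where
  field
    to                 : Group.Carrier G → Group.Carrier H
    isGroupIsomorphism : IsGroupIsomorphism (Group.rawGroup G) (Group.rawGroup H) to

  open IsGroupIsomorphism isGroupIsomorphism public

≅-comm : (A : AbelianGroup a ℓ₁) (K : Group k ℓk) → AbelianGroup.group A ≅ K →
         Commutative (Group._≈_ K) (Group._∙_ K)
≅-comm A K φ x y = begin
  x ∙ y            ≈⟨ ∙-cong (sym (image x)) (sym (image y)) ⟩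
  to x′ ∙ to y′    ≈⟨ sym (∙-homo x′ y′) ⟩
  to (x′ A.∙ y′)   ≈⟨ ⟦⟧-cong (A.comm x′ y′) ⟩
  to (y′ A.∙ x′)   ≈⟨ ∙-homo y′ x′ ⟩
  to y′ ∙ to x′    ≈⟨ ∙-cong (image y) (image x) ⟩
  y ∙ x            ∎
  where
  module A = AbelianGroup A
  open Group K
  open _≅_ φ using (to; ∙-homo; ⟦⟧-cong; surjective)
  open SetoidReasoning setoid
  x′ = proj₁ (surjective x)
  y′ = proj₁ (surjective y)
  image : ∀ z → to (proj₁ (surjective z)) ≈ z
  image z = proj₂ (surjective z) A.refl

record Subgroup (G : Group a ℓ) p : Set (a ⊔ ℓ ⊔ suc p) where
  open Group G
  field
    member      : Pred Carrier p
    member-resp : member Respects _≈_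
    ∙-closed    : ∀ {x y} → x ∈ member → y ∈ member → x ∙ y ∈ member
    ε-closed    : ε ∈ member
    ⁻¹-closed   : ∀ {x} → x ∈ member → x ⁻¹ ∈ member

  group : Group (a ⊔ p) ℓ
  group = record
    { Carrier = ∃ member
    ; _≈_     = λ x y → proj₁ x ≈ proj₁ y
    ; _∙_     = λ x y → proj₁ x ∙ proj₁ y , ∙-closed (proj₂ x) (proj₂ y)
    ; ε       = ε , ε-closed
    ; _⁻¹     = λ x → proj₁ x ⁻¹ , ⁻¹-closed (proj₂ x)
    ; isGroup = record
      { isMonoid = record
        { isSemigroup = record
          { isMagma = record
            { isEquivalence = record { refl = refl ; sym = sym ; trans = trans }
            ; ∙-cong        = ∙-cong
            }
          ; assoc = λ x y z → assoc (proj₁ x) (proj₁ y) (proj₁ z)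
          }
        ; identity = (λ x → identityˡ (proj₁ x)) , (λ x → identityʳ (proj₁ x))
        }
      ; inverse = (λ x → inverseˡ (proj₁ x)) , (λ x → inverseʳ (proj₁ x))
      ; ⁻¹-cong = ⁻¹-cong
      }
    }

-- On a finite carrier equality is decidable, so these are exactly the
-- ordinary fields with q elements.
record FiniteField (q : ℕ) c ℓ₁ ℓ₂ : Set (suc (c ⊔ ℓ₁ ⊔ ℓ₂)) where
  field
    heytingField : HeytingField c ℓ₁ ℓ₂

  open HeytingField heytingField public
  open CommutativeRing (HeytingCommutativeRing.commutativeRing heytingCommutativeRing) public
    using (+-group; +-abelianGroup)

  field
    size : HasSize setoid q

  _≟_ : Decidable _≈_
  _≟_ = via-injection (Inverse⇒Injection (Symmetry.inverse size)) Fin._≟_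

Matrix : Set a → ℕ → ℕ → Set a
Matrix A m n = Fin m → Fin n → A

map : {A : Set a} {B : Set b} → (A → B) → Matrix A m n → Matrix B m n
map φ H i j = φ (H i j)

module _ (F : FiniteField q c ℓ₁ ℓ₂) where
  open FiniteField F

  record IsGH (H : Matrix Carrier v v) : Set c where
    field
      q∣v : q ∣ v
      -- quotient q∣v is v/q
      balanced : ∀ {i j} → i < j → ∀ a →
        count (_≟ a) (tabulate λ k → H i k - H j k) ≡ quotient q∣v

  record IsNormalized (H : Matrix Carrier v v) : Set ℓ₁ where
    field
      firstRow    : ∀ i j → toℕ i ≡ 0 → H i j ≈ 0#
      firstColumn : ∀ i j → toℕ j ≡ 0 → H i j ≈ 0#

  infix 4 _≋_
  _≋_ : Rel (Vector Carrier n) ℓ₁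
  x ≋ y = ∀ i → x i ≈ y i

  GHCode : Matrix Carrier m n → Pred (Vector Carrier n) (c ⊔ ℓ₁)
  GHCode H x = ∃[ i ] ∃[ α ] x ≋ (λ j → H i j + α)

  permute : Permutation′ n → Vector Carrier n → Vector Carrier n
  permute π y i = y (π ⟨$⟩ˡ i)

  IsConstant : Pred (Vector Carrier n) (c ⊔ ℓ₁)
  IsConstant x = ∃[ α ] x ≋ (λ _ → α)

  record FullPropelinear {n} (C : Pred (Vector Carrier n) p) : Set (c ⊔ ℓ₁ ⊔ p) where
    Codeword : Set (c ⊔ p)
    Codeword = ∃ C

    word : Codeword → Vector Carrier n
    word = proj₁

    field
      0∈C    : (λ _ → 0#) ∈ C
      π      : Codeword → Permutation′ n
      -- π depends only on the word, not on how its entries are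
      -- represented nor on the proof of its membership.
      π-cong : ∀ x y → word x ≋ word y → π x Perm.≈ π y

    translate : Codeword → Vector Carrier n → Vector Carrier n
    translate x y i = word x i + permute (π x) y i

    -- x ⋆ C ⊆ C and C ⊆ x ⋆ C
    field
      ⋆-closed : ∀ x y → translate x (word y) ∈ C
      ⋆-onto   : ∀ x z → ∃[ y ] translate x (word y) ≋ word z

    infixl 7 _⋆_
    _⋆_ : Codeword → Codeword → Codeword
    x ⋆ y = translate x (word y) , ⋆-closed x y

    -- _∘ₚ_ composes from left to right, so π y comes first.
    field
      π-homo     : ∀ x y → π (x ⋆ y) Perm.≈ (π y ∘ₚ π x)
      π-free     : ∀ x → ¬ IsConstant (word x) → ∀ i → π x ⟨$⟩ʳ i ≢ i
      π-constant : ∀ x → IsConstant (word x) → π x Perm.≈ Perm.id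

    private
      ≈⇒≡ˡ : ∀ (σ τ : Permutation′ n) → σ Perm.≈ τ → ∀ i → σ ⟨$⟩ˡ i ≡ τ ⟨$⟩ˡ i
      ≈⇒≡ˡ σ τ σ≈τ i = ≡.trans
        (≡.cong (σ ⟨$⟩ˡ_) (≡.sym (≡.trans (σ≈τ (τ ⟨$⟩ˡ i)) (Perm.inverseʳ τ))))
        (Perm.inverseˡ σ)

      reindex : ∀ (y : Vector Carrier n) {i j} → i ≡ j → y i ≈ y j
      reindex y i≡j = reflexive (≡.cong y i≡j)

      zeroᶜ : Codeword
      zeroᶜ = (λ _ → 0#) , 0∈C

      infix 4 _≈ᶜ_
      _≈ᶜ_ : Rel Codeword ℓ₁
      x ≈ᶜ y = word x ≋ word y

      ⋆-cong : ∀ {x y u v} → x ≈ᶜ y → u ≈ᶜ v → (x ⋆ u) ≈ᶜ (y ⋆ v)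
      ⋆-cong {x} {y} {u} {v} x≈y u≈v i = +-cong (x≈y i) (trans (u≈v _)
        (reindex (word v) (≈⇒≡ˡ (π x) (π y) (π-cong x y x≈y) i)))

      ⋆-assoc : ∀ x y z → ((x ⋆ y) ⋆ z) ≈ᶜ (x ⋆ (y ⋆ z))
      ⋆-assoc x y z i = trans
        (+-congˡ (reindex (word z) (≈⇒≡ˡ (π (x ⋆ y)) (π y ∘ₚ π x) (π-homo x y) i)))
        (+-assoc _ _ _)

      ⋆-identityˡ : ∀ x → (zeroᶜ ⋆ x) ≈ᶜ x
      ⋆-identityˡ x i = trans (+-identityˡ _)
        (reindex (word x) (≈⇒≡ˡ (π zeroᶜ) Perm.id (π-constant zeroᶜ (0# , λ _ → refl)) i))

      ⋆-identityʳ : ∀ x → (x ⋆ zeroᶜ) ≈ᶜ x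
      ⋆-identityʳ x i = +-identityʳ _

      inv : Codeword → Codeword
      inv x = proj₁ (⋆-onto x zeroᶜ)

      ⋆-setoid : Setoid (c ⊔ p) ℓ₁
      ⋆-setoid = record
        { Carrier       = Codeword
        ; _≈_           = _≈ᶜ_
        ; isEquivalence = record
          { refl  = λ _ → refl
          ; sym   = λ x≈y i → sym (x≈y i)
          ; trans = λ x≈y y≈z i → trans (x≈y i) (y≈z i)
          }
        }

      open SetoidReasoning ⋆-setoid
      module ≈ᶜ = Setoid ⋆-setoid

      ⋆-inverseʳ : ∀ x → (x ⋆ inv x) ≈ᶜ zeroᶜ
      ⋆-inverseʳ x = proj₂ (⋆-onto x zeroᶜ)

      ⋆-congˡ : ∀ x y z → y ≈ᶜ z → (x ⋆ y) ≈ᶜ (x ⋆ z)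
      ⋆-congˡ x y z = ⋆-cong {x} {x} {y} {z} (λ _ → refl)

      ⋆-congʳ : ∀ x y z → x ≈ᶜ y → (x ⋆ z) ≈ᶜ (y ⋆ z)
      ⋆-congʳ x y z x≈y = ⋆-cong {x} {y} {z} {z} x≈y (λ _ → refl)

      cancelˡ : ∀ x y z → (x ⋆ y) ≈ᶜ zeroᶜ → (x ⋆ (y ⋆ z)) ≈ᶜ z
      cancelˡ x y z xy≈0 = begin
        x ⋆ (y ⋆ z)   ≈⟨ ⋆-assoc x y z ⟨
        (x ⋆ y) ⋆ z   ≈⟨ ⋆-congʳ (x ⋆ y) zeroᶜ z xy≈0 ⟩
        zeroᶜ ⋆ z     ≈⟨ ⋆-identityˡ z ⟩
        z             ∎

      inv-involutive : ∀ x → inv (inv x) ≈ᶜ x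
      inv-involutive x = begin
        inv (inv x)                 ≈⟨ cancelˡ x (inv x) (inv (inv x)) (⋆-inverseʳ x) ⟨
        x ⋆ (inv x ⋆ inv (inv x))   ≈⟨ ⋆-congˡ x (inv x ⋆ inv (inv x)) zeroᶜ (⋆-inverseʳ (inv x)) ⟩
        x ⋆ zeroᶜ                   ≈⟨ ⋆-identityʳ x ⟩
        x                           ∎

      ⋆-inverseˡ : ∀ x → (inv x ⋆ x) ≈ᶜ zeroᶜ
      ⋆-inverseˡ x = begin
        inv x ⋆ x             ≈⟨ ⋆-congˡ (inv x) (inv (inv x)) x (inv-involutive x) ⟨
        inv x ⋆ inv (inv x)   ≈⟨ ⋆-inverseʳ (inv x) ⟩
        zeroᶜ                 ∎

      inv-cong : ∀ {x y} → x ≈ᶜ y → inv x ≈ᶜ inv y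
      inv-cong {x} {y} x≈y = begin
        inv x                 ≈⟨ cancelˡ (inv y) y (inv x) (⋆-inverseˡ y) ⟨
        inv y ⋆ (y ⋆ inv x)   ≈⟨ ⋆-congˡ (inv y) (y ⋆ inv x) (x ⋆ inv x) (⋆-congʳ y x (inv x) (≈ᶜ.sym {x} {y} x≈y)) ⟩
        inv y ⋆ (x ⋆ inv x)   ≈⟨ ⋆-congˡ (inv y) (x ⋆ inv x) zeroᶜ (⋆-inverseʳ x) ⟩
        inv y ⋆ zeroᶜ         ≈⟨ ⋆-identityʳ (inv y) ⟩
        inv y                 ∎

    ⋆-group : Group (c ⊔ p) ℓ₁
    ⋆-group = record
      { Carrier = Codeword
      ; _≈_     = _≈ᶜ_
      ; _∙_     = _⋆_
      ; ε       = zeroᶜ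
      ; _⁻¹     = inv
      ; isGroup = record
        { isMonoid = record
          { isSemigroup = record
            { isMagma = record
              { isEquivalence = ≈ᶜ.isEquivalence
              ; ∙-cong        = λ {x} {y} {u} {v} → ⋆-cong {x} {y} {u} {v}
              }
            ; assoc = ⋆-assoc
            }
          ; identity = ⋆-identityˡ , ⋆-identityʳ
          }
        ; inverse = ⋆-inverseˡ , ⋆-inverseʳ
        ; ⁻¹-cong = λ {x} {y} → inv-cong {x} {y}
        }
      }

record Cocycle (G : Group a ℓ) (K : Group k ℓk) : Set (a ⊔ ℓ ⊔ k ⊔ ℓk) where
  private
    module G = Group G
    module K = Group K
  field
    ψ          : G.Carrier → G.Carrier → K.Carrier
    ψ-cong     : ∀ {g g′ h h′} → g G.≈ g′ → h G.≈ h′ → ψ g h K.≈ ψ g′ h′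
    cocycle    : ∀ g h x → ψ g h K.∙ ψ (g G.∙ h) x K.≈ ψ g (h G.∙ x) K.∙ ψ h x
    normalizeˡ : ∀ g → ψ G.ε g K.≈ K.ε
    normalizeʳ : ∀ g → ψ g G.ε K.≈ K.ε

module _ {G : Group a ℓ} {K : Group k ℓk} where
  private
    module G = Group G
    module K = Group K

  -- Rows and columns are indexed independently; both indexings being
  -- bijections forces G to be finite of order v.
  record IsCocyclic (M : Matrix K.Carrier v v) (ψ : Cocycle G K) : Set (a ⊔ ℓ ⊔ ℓk) where
    open Cocycle ψ renaming (ψ to ⟨_,_⟩) using ()
    field
      row    : HasSize G.setoid v
      column : HasSize G.setoid v
      entry  : ∀ i j → M i j K.≈ ⟨ Inverse.to row i , Inverse.to column j ⟩

  module _ (comm : Commutative K._≈_ K._∙_) (Ψ : Cocycle G K) where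
    open Cocycle Ψ
    private
      K-abelian : AbelianGroup k ℓk
      K-abelian = record { isAbelianGroup = record { isGroup = K.isGroup ; comm = comm } }

      open CommutativeSemigroupProperties (AbelianGroup.commutativeSemigroup K-abelian)
        using (xy∙z≈xz∙y)
      open SetoidReasoning K.setoid

      E : Set (a ⊔ k)
      E = K.Carrier × G.Carrier

      infixl 7 _·_
      _·_ : E → E → E
      (u , g) · (w , h) = (u K.∙ w) K.∙ ψ g h , g G.∙ h

      inv : E → E
      inv (u , g) = u K.⁻¹ K.∙ ψ g (g G.⁻¹) K.⁻¹ , g G.⁻¹

      ·-assoc : ∀ u w x g h i →
        (((u K.∙ w) K.∙ ψ g h) K.∙ x) K.∙ ψ (g G.∙ h) i K.≈
        (u K.∙ ((w K.∙ x) K.∙ ψ h i)) K.∙ ψ g (h G.∙ i)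
      ·-assoc u w x g h i = begin
        (((u K.∙ w) K.∙ ψ g h) K.∙ x) K.∙ ψ (g G.∙ h) i   ≈⟨ K.∙-congʳ (xy∙z≈xz∙y _ _ _) ⟩
        (((u K.∙ w) K.∙ x) K.∙ ψ g h) K.∙ ψ (g G.∙ h) i   ≈⟨ K.assoc _ _ _ ⟩
        ((u K.∙ w) K.∙ x) K.∙ (ψ g h K.∙ ψ (g G.∙ h) i)   ≈⟨ K.∙-cong (K.assoc _ _ _) (cocycle g h i) ⟩
        (u K.∙ (w K.∙ x)) K.∙ (ψ g (h G.∙ i) K.∙ ψ h i)   ≈⟨ K.∙-congˡ (comm _ _) ⟩
        (u K.∙ (w K.∙ x)) K.∙ (ψ h i K.∙ ψ g (h G.∙ i))   ≈⟨ K.assoc _ _ _ ⟨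
        ((u K.∙ (w K.∙ x)) K.∙ ψ h i) K.∙ ψ g (h G.∙ i)   ≈⟨ K.∙-congʳ (K.assoc _ _ _) ⟩
        (u K.∙ ((w K.∙ x) K.∙ ψ h i)) K.∙ ψ g (h G.∙ i)   ∎

      ψ-inverse : ∀ g → ψ (g G.⁻¹) g K.≈ ψ g (g G.⁻¹)
      ψ-inverse g = begin
        ψ (g G.⁻¹) g                              ≈⟨ K.identityˡ _ ⟨
        K.ε K.∙ ψ (g G.⁻¹) g                      ≈⟨ K.∙-congʳ (normalizeʳ g) ⟨
        ψ g G.ε K.∙ ψ (g G.⁻¹) g                  ≈⟨ K.∙-congʳ (ψ-cong G.refl (G.inverseˡ g)) ⟨
        ψ g (g G.⁻¹ G.∙ g) K.∙ ψ (g G.⁻¹) g       ≈⟨ cocycle g (g G.⁻¹) g ⟨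
        ψ g (g G.⁻¹) K.∙ ψ (g G.∙ g G.⁻¹) g       ≈⟨ K.∙-congˡ (ψ-cong (G.inverseʳ g) G.refl) ⟩
        ψ g (g G.⁻¹) K.∙ ψ G.ε g                  ≈⟨ K.∙-congˡ (normalizeˡ g) ⟩
        ψ g (g G.⁻¹) K.∙ K.ε                      ≈⟨ K.identityʳ _ ⟩
        ψ g (g G.⁻¹)                              ∎

      ·-inverseʳ : ∀ u g → (u K.∙ (u K.⁻¹ K.∙ ψ g (g G.⁻¹) K.⁻¹)) K.∙ ψ g (g G.⁻¹) K.≈ K.ε
      ·-inverseʳ u g = begin
        (u K.∙ (u K.⁻¹ K.∙ ψ g (g G.⁻¹) K.⁻¹)) K.∙ ψ g (g G.⁻¹)   ≈⟨ K.∙-congʳ (K.assoc _ _ _) ⟨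
        ((u K.∙ u K.⁻¹) K.∙ ψ g (g G.⁻¹) K.⁻¹) K.∙ ψ g (g G.⁻¹)   ≈⟨ K.assoc _ _ _ ⟩
        (u K.∙ u K.⁻¹) K.∙ (ψ g (g G.⁻¹) K.⁻¹ K.∙ ψ g (g G.⁻¹))   ≈⟨ K.∙-cong (K.inverseʳ u) (K.inverseˡ _) ⟩
        K.ε K.∙ K.ε                                               ≈⟨ K.identityˡ K.ε ⟩
        K.ε                                                       ∎

      ·-identityˡ : ∀ u g → (K.ε K.∙ u) K.∙ ψ G.ε g K.≈ u
      ·-identityˡ u g = K.trans (K.∙-cong (K.identityˡ u) (normalizeˡ g)) (K.identityʳ u)

      ·-identityʳ : ∀ u g → (u K.∙ K.ε) K.∙ ψ g G.ε K.≈ u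
      ·-identityʳ u g = K.trans (K.∙-cong (K.identityʳ u) (normalizeʳ g)) (K.identityʳ u)

    extension : Group (a ⊔ k) (ℓ ⊔ ℓk)
    extension = record
      { Carrier = E
      ; _≈_     = λ (u , g) (w , h) → u K.≈ w × g G.≈ h
      ; _∙_     = _·_
      ; ε       = K.ε , G.ε
      ; _⁻¹     = inv
      ; isGroup = record
        { isMonoid = record
          { isSemigroup = record
            { isMagma = record
              { isEquivalence = record
                { refl  = K.refl , G.refl
                ; sym   = λ (p , r) → K.sym p , G.sym r
                ; trans = λ (p , r) (p′ , r′) → K.trans p p′ , G.trans r r′
                }
              ; ∙-cong = λ (p , r) (p′ , r′) →
                  K.∙-cong (K.∙-cong p p′) (ψ-cong r r′) , G.∙-cong r r′
              }
            ; assoc = λ (u , g) (w , h) (x , i) → ·-assoc u w x g h i , G.assoc g h i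
            }
          ; identity = (λ (u , g) → ·-identityˡ u g , G.identityˡ g)
                     , (λ (u , g) → ·-identityʳ u g , G.identityʳ g)
          }
        ; inverse =
            (λ (u , g) → K.trans (K.∙-cong (comm _ _) (ψ-inverse g)) (·-inverseʳ u g) , G.inverseˡ g)
          , (λ (u , g) → ·-inverseʳ u g , G.inverseʳ g)
        ; ⁻¹-cong = λ (p , r) →
            K.∙-cong (K.⁻¹-cong p) (K.⁻¹-cong (ψ-cong r (G.⁻¹-cong r))) , G.⁻¹-cong r
        }
      }

module _ (K : Group k ℓk) where
  open Group K

  -- An enumeration k₀ = 1, k₁, …, k_{q-1} of K.
  record Enumeration (q : ℕ) : Set (k ⊔ ℓk) where
    field
      order : HasOrder K q

    elem : Fin q → Carrier
    elem = Inverse.to order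

    field
      elem₀ : ∀ i → toℕ i ≡ 0 → elem i ≈ ε

  -- Row (column) i * v + r lies in block row (column) i at position r,
  -- and remQuot v recovers the pair (i , r).
  expand : Enumeration q → Matrix Carrier v v → Matrix Carrier (q * v) (q * v)
  expand {v = v} e M r c = entry (remQuot v r) (remQuot v c)
    where
    open Enumeration e
    entry : Fin _ × Fin v → Fin _ × Fin v → Carrier
    entry (i , r′) (j , c′) = (elem i ∙ elem j) ∙ M r′ c′

  -- The entries of A lie in a group, so a permutation matrix P is given by
  -- the permutation σ with P eᵢ = e_{σ i}.  Products of matrices are then
  -- composites of permutations, and (P A Qᵀ)ᵢⱼ is A at (σ⁻¹ i , τ⁻¹ j).
  record Automorphism (A : Matrix Carrier m n) : Set ℓk where
    field
      σ         : Permutation′ m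
      τ         : Permutation′ n
      preserves : ∀ i j → A (σ ⟨$⟩ˡ i) (τ ⟨$⟩ˡ j) ≈ A i j

  PAut : Matrix Carrier m n → Group ℓk 0ℓ
  PAut {m} {n} A = record
    { Carrier = Automorphism A
    ; _≈_     = λ P Q → σ P Perm.≈ σ Q × τ P Perm.≈ τ Q
    ; _∙_     = λ P Q → record
      { σ         = σ Q ∘ₚ σ P
      ; τ         = τ Q ∘ₚ τ P
      ; preserves = λ i j → trans (preserves Q _ _) (preserves P i j)
      }
    ; ε       = record { σ = Perm.id ; τ = Perm.id ; preserves = λ _ _ → refl }
    ; _⁻¹     = λ P → record
      { σ         = Perm.flip (σ P)
      ; τ         = Perm.flip (τ P)
      ; preserves = λ i j → trans (sym (preserves P _ _))
          (reflexive (≡.cong₂ A (Perm.inverseˡ (σ P)) (Perm.inverseˡ (τ P))))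
      }
    ; isGroup = record
      { isMonoid = record
        { isSemigroup = record
          { isMagma = record
            { isEquivalence = record
              { refl  = (λ _ → ≡.refl) , (λ _ → ≡.refl)
              ; sym   = λ (s , t) → (λ i → ≡.sym (s i)) , (λ j → ≡.sym (t j))
              ; trans = λ (s , t) (s′ , t′) →
                  (λ i → ≡.trans (s i) (s′ i)) , (λ j → ≡.trans (t j) (t′ j))
              }
            ; ∙-cong = λ {P} {P′} {Q} {Q′} (s , t) (s′ , t′) →
                ∘-cong (σ P) (σ P′) (σ Q) (σ Q′) s s′ , ∘-cong (τ P) (τ P′) (τ Q) (τ Q′) t t′
            }
          ; assoc = λ _ _ _ → (λ _ → ≡.refl) , (λ _ → ≡.refl)
          }
        ; identity = (λ _ → (λ _ → ≡.refl) , (λ _ → ≡.refl))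
                   , (λ _ → (λ _ → ≡.refl) , (λ _ → ≡.refl))
        }
      ; inverse = (λ P → (λ _ → Perm.inverseˡ (σ P)) , (λ _ → Perm.inverseˡ (τ P)))
                , (λ P → (λ _ → Perm.inverseʳ (σ P)) , (λ _ → Perm.inverseʳ (τ P)))
      ; ⁻¹-cong = λ {P} {Q} (s , t) → flip-cong (σ P) (σ Q) s , flip-cong (τ P) (τ Q) t
      }
    }
    where
    open Automorphism

    ∘-cong : ∀ {l} (α α′ β β′ : Permutation′ l) → α Perm.≈ α′ → β Perm.≈ β′ →
             (β ∘ₚ α) Perm.≈ (β′ ∘ₚ α′)
    ∘-cong α α′ β β′ s t i = ≡.trans (s (β ⟨$⟩ʳ i)) (≡.cong (α′ ⟨$⟩ʳ_) (t i))

    flip-cong : ∀ {l} (α β : Permutation′ l) → α Perm.≈ β → Perm.flip α Perm.≈ Perm.flip β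
    flip-cong α β s i = ≡.trans
      (≡.cong (α ⟨$⟩ˡ_) (≡.sym (≡.trans (s (β ⟨$⟩ˡ i)) (Perm.inverseʳ β))))
      (Perm.inverseˡ α)

  module _ {A : Matrix Carrier m n} (R : Subgroup (PAut A) p) where
    open Automorphism
    open Subgroup R using (member)
    open Group (PAut A) using () renaming (_≈_ to _≈ᴾ_; ε to 1ᴾ)

    record IsRegular : Set (ℓk ⊔ p) where
      field
        row-transitive    : ∀ i i′ → ∃[ P ] P ∈ member × σ P ⟨$⟩ʳ i ≡ i′
        row-free          : ∀ P → P ∈ member → ∀ i → σ P ⟨$⟩ʳ i ≡ i → P ≈ᴾ 1ᴾ
        column-transitive : ∀ j j′ → ∃[ P ] P ∈ member × τ P ⟨$⟩ʳ j ≡ j′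
        column-free       : ∀ P → P ∈ member → ∀ j → τ P ⟨$⟩ʳ j ≡ j → P ≈ᴾ 1ᴾ

{-# OPTIONS --safe #-}
module Submission where

-- A codeword h_i + α1 corresponds to (φ(α) , i) in an extension by K of a group
-- structure on the rows.  Given a propelinear structure, the constant part of
-- h_x ⋆ h_y = h_x + π_x(h_y) is its first entry, which is the entry of h_y at
-- π_x⁻¹(0), where 0 is the first coordinate.  The π_x act regularly on the
-- coordinates, so labelling π_x⁻¹(0) by x makes H itself a cocycle, for the
-- opposite of the quotient of the code by the constants.  Conversely, the cocycle
-- identity says that row g with its columns translated by h is row gh minus row h,
-- up to a constant, so left translations of G yield the permutations π_h.
-- Finally, the expanded matrix has the K-component of x · y at position (x , y),
-- so the extension acts regularly on it by (x , y) ↦ (x a⁻¹ , a y).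

open import Defs
open import Level using (Level; 0ℓ)
open import Data.Nat.Base as ℕ using (ℕ; suc; NonZero)
import Data.Nat.Properties as ℕ
open import Data.Nat.Divisibility using (quotient; _∣_)
open import Data.Nat.Primality using (prime⇒nonTrivial)
open import Data.Fin.Base as Fin using (Fin; zero; suc; punchOut; remQuot)
import Data.Fin.Properties as Fin
open import Data.Fin.Permutation as Perm using (Permutation′; _⟨$⟩ʳ_; _⟨$⟩ˡ_; _∘ₚ_)
open import Data.Product.Base as Product using (∃; ∃-syntax; Σ-syntax; _×_; _,_; proj₁; proj₂)
open import Data.Vec.Base using (tabulate; count)
open import Data.Vec.Functional using (Vector)
open import Function.Base using (_∘_)
open import Function.Bundles using (Inverse)
import Function.Construct.Composition as ∘-Inverse
import Function.Construct.Symmetry as Symmetry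
open import Function.Consequences.Setoid using (strictlySurjective⇒surjective)
open import Function.Definitions using (Injective)
open import Relation.Nullary using (¬_; yes; no; contradiction)
open import Relation.Unary using (Pred; _∈_) renaming (Decidable to Decidable₁)
open import Relation.Binary.Bundles using (Setoid)
open import Relation.Binary.Definitions using (tri<; tri≈; tri>)
open import Relation.Binary.PropositionalEquality as ≡ using (_≡_; _≢_)
import Relation.Binary.Reasoning.Setoid as SetoidReasoning
open import Algebra.Bundles using (Group; AbelianGroup)
open import Algebra.Definitions using (Commutative)
import Algebra.Morphism.Construct.Composition as ∘-Morphism
import Algebra.Properties.AbelianGroup as AbelianGroupProperties
import Algebra.Properties.CommutativeSemigroup as CommutativeSemigroupProperties
import Algebra.Properties.Group as GroupProperties

private
  variable
    a b c k ℓ ℓ₁ ℓ₂ ℓ₃ ℓk g ℓg p : Level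
    m n q v : ℕ

-- Building and combining group isomorphisms.

module _ (A : Group a ℓ₁) (B : Group b ℓ₂) where
  private
    module A = Group A
    module B = Group B
  open GroupProperties B

  ≅-fromHomo : (f : A.Carrier → B.Carrier) →
    (∀ {x y} → x A.≈ y → f x B.≈ f y) →
    (∀ x y → f (x A.∙ y) B.≈ f x B.∙ f y) →
    (∀ {x y} → f x B.≈ f y → x A.≈ y) →
    (∀ y → ∃[ x ] f x B.≈ y) →
    A ≅ B
  ≅-fromHomo f cong homo injective surjective = record
    { to                 = f
    ; isGroupIsomorphism = record
      { isGroupMonomorphism = record
        { isGroupHomomorphism = record
          { isMonoidHomomorphism = record
            { isMagmaHomomorphism = record
              { isRelHomomorphism = record { cong = cong }
              ; homo              = homo
              }
            ; ε-homo = ε-homo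
            }
          ; ⁻¹-homo = λ x → inverseˡ-unique (f (x A.⁻¹)) (f x)
              (B.trans (B.sym (homo (x A.⁻¹) x)) (B.trans (cong (A.inverseˡ x)) ε-homo))
          }
        ; injective = injective
        }
      ; surjective = strictlySurjective⇒surjective A.setoid B.setoid cong surjective
      }
    }
    where
    ε-homo : f A.ε B.≈ B.ε
    ε-homo = identityˡ-unique (f A.ε) (f A.ε)
      (B.trans (B.sym (homo A.ε A.ε)) (cong (A.identityˡ A.ε)))

  -- Following `f` by inversion restores the order of products.
  ≅-fromAntiHomo : (f : A.Carrier → B.Carrier) →
    (∀ {x y} → x A.≈ y → f x B.≈ f y) →
    (∀ x y → f (x A.∙ y) B.≈ f y B.∙ f x) →
    (∀ {x y} → f x B.≈ f y → x A.≈ y) →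
    (∀ y → ∃[ x ] f x B.≈ y) →
    A ≅ B
  ≅-fromAntiHomo f cong antiHomo injective surjective = ≅-fromHomo
    (λ x → f x B.⁻¹)
    (λ x≈y → B.⁻¹-cong (cong x≈y))
    (λ x y → B.trans (B.⁻¹-cong (antiHomo x y)) (⁻¹-anti-homo-∙ (f y) (f x)))
    (λ fx≈fy → injective (⁻¹-injective fx≈fy))
    (λ y → proj₁ (surjective (y B.⁻¹)) ,
           B.trans (B.⁻¹-cong (proj₂ (surjective (y B.⁻¹)))) (⁻¹-involutive y))

module _ {A : Group a ℓ₁} {B : Group b ℓ₂} where
  private
    module A = Group A
    module B = Group B

  ≅-sym : A ≅ B → B ≅ A
  ≅-sym f = ≅-fromHomo B A from
    (λ x≈y → F.injective (B.trans (to-from _) (B.trans x≈y (B.sym (to-from _)))))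
    (λ x y → F.injective (B.trans (to-from _)
      (B.sym (B.trans (F.∙-homo _ _) (B.∙-cong (to-from x) (to-from y))))))
    (λ fx≈fy → B.trans (B.sym (to-from _)) (B.trans (F.⟦⟧-cong fx≈fy) (to-from _)))
    (λ x → F.to x , F.injective (to-from (F.to x)))
    where
    module F = _≅_ f
    from : B.Carrier → A.Carrier
    from y = proj₁ (F.surjective y)
    to-from : ∀ y → F.to (from y) B.≈ y
    to-from y = proj₂ (F.surjective y) A.refl

≅-trans : {A : Group a ℓ₁} {B : Group b ℓ₂} {C : Group c ℓ₃} → A ≅ B → B ≅ C → A ≅ C
≅-trans {C = C} f g = record
  { to                 = _≅_.to g ∘ _≅_.to f
  ; isGroupIsomorphism = ∘-Morphism.isGroupIsomorphism (Group.trans C)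
      (_≅_.isGroupIsomorphism f) (_≅_.isGroupIsomorphism g)
  }

-- Permutations of finite sets and translations in groups.

≈⇒≡ˡ : (π ρ : Permutation′ n) → π Perm.≈ ρ → ∀ i → π ⟨$⟩ˡ i ≡ ρ ⟨$⟩ˡ i
≈⇒≡ˡ π ρ π≈ρ i = ≡.trans
  (≡.cong (π ⟨$⟩ˡ_) (≡.sym (≡.trans (π≈ρ (ρ ⟨$⟩ˡ i)) (Perm.inverseʳ ρ))))
  (Perm.inverseˡ π)

-- A value missed by f could be punched out of the codomain.
injective⇒surjective : (f : Fin n → Fin n) → Injective _≡_ _≡_ f → ∀ y → ∃[ x ] f x ≡ y
injective⇒surjective {suc n} f injective y with Fin.any? (λ x → f x Fin.≟ y)
... | yes hit  = hit
... | no  miss = contradiction (Fin.injective⇒≤ punched) ℕ.1+n≰n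
  where
  y≢f : ∀ x → y ≢ f x
  y≢f x y≡fx = miss (x , ≡.sym y≡fx)
  punched : Injective _≡_ _≡_ (λ x → punchOut (y≢f x))
  punched eq = injective (Fin.punchOut-injective (y≢f _) (y≢f _) eq)

injective⇒permutation : (f : Fin n → Fin n) → Injective _≡_ _≡_ f → Permutation′ n
injective⇒permutation f injective = Perm.permutation f (proj₁ ∘ surjective)
  (proj₂ ∘ surjective) (λ x → injective (proj₂ (surjective (f x))))
  where surjective = injective⇒surjective f injective

module _ (S : Setoid a ℓ) (size : HasSize S n) where
  conjugate : Inverse S S → Permutation′ n
  conjugate I = ∘-Inverse.inverse size (∘-Inverse.inverse I (Symmetry.inverse size))

module _ (G : Group a ℓ) where
  open Group G
  open GroupProperties G

  leftTranslation : Carrier → Inverse setoid setoid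
  leftTranslation x = record
    { to        = x ∙_
    ; from      = x ⁻¹ ∙_
    ; to-cong   = ∙-congˡ
    ; from-cong = ∙-congˡ
    ; inverse   = (λ {y} {z} z≈ → trans (∙-congˡ z≈) (\\-leftDividesˡ x y))
                , (λ {y} {z} z≈ → trans (∙-congˡ z≈) (\\-leftDividesʳ x y))
    }

  rightTranslation : Carrier → Inverse setoid setoid
  rightTranslation x = record
    { to        = _∙ x
    ; from      = _∙ x ⁻¹
    ; to-cong   = ∙-congʳ
    ; from-cong = ∙-congʳ
    ; inverse   = (λ {y} {z} z≈ → trans (∙-congʳ z≈) (//-rightDividesˡ x y))
                , (λ {y} {z} z≈ → trans (∙-congʳ z≈) (//-rightDividesʳ x y))
    }

-- Regular automorphism groups of group-developed matrices.

module GroupDeveloped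
  (K : Group k ℓk) (E : Group a ℓ) (row : HasOrder E m) (column : HasOrder E n)
  (χ : Group.Carrier E → Group.Carrier K)
  (χ-cong : ∀ {x y} → Group._≈_ E x y → Group._≈_ K (χ x) (χ y))
  (A : Matrix (Group.Carrier K) m n)
  (developed : ∀ i j → Group._≈_ K (A i j) (χ (Group._∙_ E (Inverse.to row i) (Inverse.to column j))))
  where
  private
    module K = Group K
    module Row = Inverse row
    module Column = Inverse column
  open Group E
  open GroupProperties E
  open Group (PAut K A) using () renaming (_≈_ to _≈ᴾ_)
  private
    module P = Group (PAut K A)

  -- Inverting `x` on the row side has two effects: the factors cancel in the product of a row label
  -- and a column label, and right multiplication respects the order of composition.
  automorphism : Carrier → Automorphism K A
  automorphism x = record
    { σ         = conjugate setoid row (rightTranslation E (x ⁻¹))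
    ; τ         = conjugate setoid column (leftTranslation E x)
    -- Automorphisms evaluate the matrix at the inverse permutations, hence the double inverse on
    -- the rows.
    ; preserves = λ i j → K.trans (developed _ _) (K.trans (χ-cong (begin
        Row.to (Row.from (Row.to i ∙ x ⁻¹ ⁻¹)) ∙ Column.to (Column.from (x ⁻¹ ∙ Column.to j))
          ≈⟨ ∙-cong (Row.strictlyInverseˡ _) (Column.strictlyInverseˡ _) ⟩
        (Row.to i ∙ x ⁻¹ ⁻¹) ∙ (x ⁻¹ ∙ Column.to j)
          ≈⟨ assoc _ _ _ ⟨
        ((Row.to i ∙ x ⁻¹ ⁻¹) ∙ x ⁻¹) ∙ Column.to j
          ≈⟨ ∙-congʳ (//-rightDividesˡ (x ⁻¹) (Row.to i)) ⟩
        Row.to i ∙ Column.to j ∎)) (K.sym (developed i j)))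
    }
    where open SetoidReasoning setoid

  automorphism-cong : ∀ {x y} → x ≈ y → automorphism x ≈ᴾ automorphism y
  automorphism-cong x≈y =
    (λ _ → Row.from-cong (∙-congˡ (⁻¹-cong x≈y))) , (λ _ → Column.from-cong (∙-congʳ x≈y))

  automorphism-homo : ∀ x y → automorphism (x ∙ y) ≈ᴾ automorphism x P.∙ automorphism y
  automorphism-homo x y =
      (λ i → Row.from-cong (trans (∙-congˡ (⁻¹-anti-homo-∙ x y))
        (trans (sym (assoc _ _ _)) (∙-congʳ (sym (Row.strictlyInverseˡ _))))))
    , (λ j → Column.from-cong (trans (assoc _ _ _) (∙-congˡ (sym (Column.strictlyInverseˡ _)))))

  automorphism-ε : automorphism ε ≈ᴾ P.ε
  automorphism-ε =
      (λ i → Row.inverseʳ (trans (∙-congˡ ε⁻¹≈ε) (identityʳ _)))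
    , (λ j → Column.inverseʳ (identityˡ _))

  σ-fixed : ∀ x i → Automorphism.σ (automorphism x) ⟨$⟩ʳ i ≡ i → x ≈ ε
  σ-fixed x i fixed = ⁻¹-injective (trans
    (identityʳ-unique (Row.to i) (x ⁻¹) (trans (sym (Row.strictlyInverseˡ _)) (Row.to-cong fixed)))
    (sym ε⁻¹≈ε))

  τ-fixed : ∀ x j → Automorphism.τ (automorphism x) ⟨$⟩ʳ j ≡ j → x ≈ ε
  τ-fixed x j fixed = identityˡ-unique x (Column.to j)
    (trans (sym (Column.strictlyInverseˡ _)) (Column.to-cong fixed))

  -- Indexing the members by rows rather than by group elements keeps
  -- membership at level 0ℓ.
  translations : Subgroup (PAut K A) 0ℓ
  translations = record
    { member      = λ P → ∃[ i ] P ≈ᴾ automorphism (Row.to i)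
    ; member-resp = λ {P} {Q} P≈Q (i , P≈i) →
        i , P.trans {Q} {P} {automorphism (Row.to i)} (P.sym {P} {Q} P≈Q) P≈i
    ; ∙-closed    = λ {P} {Q} (i , P≈i) (j , Q≈j) →
        member {P P.∙ Q} (Row.to i ∙ Row.to j)
          (P.trans {P P.∙ Q} {automorphism (Row.to i) P.∙ automorphism (Row.to j)}
            {automorphism (Row.to i ∙ Row.to j)}
            (P.∙-cong {P} {automorphism (Row.to i)} {Q} {automorphism (Row.to j)} P≈i Q≈j)
            (P.sym {automorphism (Row.to i ∙ Row.to j)} {automorphism (Row.to i) P.∙ automorphism (Row.to j)}
              (automorphism-homo (Row.to i) (Row.to j))))
    ; ε-closed    = member {P.ε} ε (P.sym {automorphism ε} {P.ε} automorphism-ε)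
    ; ⁻¹-closed   = λ {P} (i , P≈i) → member {P P.⁻¹} (Row.to i ⁻¹)
        (P.⁻¹-cong {P} {automorphism (Row.to i)} P≈i)
    }
    where
    member : ∀ {P} x → P ≈ᴾ automorphism x → ∃[ i ] P ≈ᴾ automorphism (Row.to i)
    member {P} x P≈x = Row.from x , P.trans {P} {automorphism x} {automorphism (Row.to (Row.from x))} P≈x
      (automorphism-cong (sym (Row.strictlyInverseˡ x)))

  translations-isRegular : IsRegular K translations
  translations-isRegular = record
    { row-transitive    = λ i i′ →
        -- This `x` solves `Row.to i ∙ x ⁻¹ ≈ Row.to i′`.
        let x = Row.to i′ ⁻¹ ∙ Row.to i in
        automorphism x , member x , Row.inverseʳ (begin
          Row.to i ∙ (Row.to i′ ⁻¹ ∙ Row.to i) ⁻¹  ≈⟨ ∙-congˡ (⁻¹-anti-homo-\\ _ _) ⟩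
          Row.to i ∙ (Row.to i ⁻¹ ∙ Row.to i′)     ≈⟨ \\-leftDividesˡ _ _ ⟩
          Row.to i′                                ∎)
    ; row-free          = λ P (i , P≈i) j fixed →
        trivial P (Row.to i) P≈i (σ-fixed (Row.to i) j (≡.trans (≡.sym (proj₁ P≈i j)) fixed))
    ; column-transitive = λ j j′ →
        let x = Column.to j′ ∙ Column.to j ⁻¹ in
        automorphism x , member x , Column.inverseʳ (//-rightDividesˡ _ _)
    ; column-free       = λ P (i , P≈i) j fixed →
        trivial P (Row.to i) P≈i (τ-fixed (Row.to i) j (≡.trans (≡.sym (proj₂ P≈i j)) fixed))
    }
    where
    open SetoidReasoning setoid

    member : ∀ x → automorphism x ∈ Subgroup.member translations
    member x = Row.from x , automorphism-cong (sym (Row.strictlyInverseˡ x))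

    trivial : ∀ P x → P ≈ᴾ automorphism x → x ≈ ε → P ≈ᴾ P.ε
    trivial P x P≈x x≈ε = P.trans {P} {automorphism x} {P.ε} P≈x
      (P.trans {automorphism x} {automorphism ε} {P.ε} (automorphism-cong x≈ε) automorphism-ε)

  ≅-translations : E ≅ Subgroup.group translations
  ≅-translations = ≅-fromHomo E (Subgroup.group translations)
    (λ x → automorphism x , Row.from x , automorphism-cong (sym (Row.strictlyInverseˡ x)))
    automorphism-cong
    automorphism-homo
    -- The image of a single column determines the translating element by cancellation;
    -- `Column.from ε` is a column sure to exist.
    (λ {x} {y} (_ , τ≈) → ∙-cancelʳ (Column.to (Column.from ε)) x y (trans
      (sym (Column.strictlyInverseˡ _))
      (trans (Column.to-cong (τ≈ (Column.from ε))) (Column.strictlyInverseˡ _))))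
    (λ (P , i , P≈i) → Row.to i , P.sym {P} {automorphism (Row.to i)} P≈i)

-- The extension group acting on the expanded matrix.

module _ {K : Group k ℓk} {G : Group g ℓg} (comm : Commutative (Group._≈_ K) (Group._∙_ K))
  (ψ : Cocycle G K) (e : Enumeration K q) where
  private
    module K = Group K
    module G = Group G
    open Enumeration e

    E : Group _ _
    E = extension comm ψ

  -- Indices are split by `remQuot`, as in `expand`, so that each row or column of the expanded
  -- matrix is labelled by its block element of `K` and its position in the block.
  extension-order : HasOrder G v → HasOrder E (q ℕ.* v)
  extension-order {v = v} size = record
    { to        = λ r → Product.map elem (Inverse.to size) (remQuot v r)
    ; from      = λ (u , x) → Fin.combine (Inverse.from order u) (Inverse.from size x)
    ; to-cong   = λ { ≡.refl → K.refl , G.refl }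
    ; from-cong = λ (u≈ , x≈) →
        ≡.cong₂ Fin.combine (Inverse.from-cong order u≈) (Inverse.from-cong size x≈)
    ; inverse   = (λ { {u , x} ≡.refl → inverseˡ′ u x })
                , (λ {r} (u≈ , x≈) → ≡.trans
                    (≡.cong₂ Fin.combine (Inverse.inverseʳ order u≈) (Inverse.inverseʳ size x≈))
                    (Fin.combine-remQuot {q} v r))
    }
    where
    inverseˡ′ : ∀ u x → Group._≈_ E (Product.map elem (Inverse.to size)
      (remQuot v (Fin.combine (Inverse.from order u) (Inverse.from size x)))) (u , x)
    inverseˡ′ u x =
        K.trans (K.reflexive (≡.cong (elem ∘ proj₁) split)) (Inverse.strictlyInverseˡ order u)
      , G.trans (G.reflexive (≡.cong (Inverse.to size ∘ proj₂) split)) (Inverse.strictlyInverseˡ size x)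
      where split = Fin.remQuot-combine {q} {v} (Inverse.from order u) (Inverse.from size x)

  regularSubgroup : {M : Matrix K.Carrier v v} → IsCocyclic M ψ →
    Σ[ R ∈ Subgroup (PAut K (expand K e M)) 0ℓ ] IsRegular K R × E ≅ Subgroup.group R
  regularSubgroup {v} {M} cocyclic = translations , translations-isRegular , ≅-translations
    where
    open IsCocyclic cocyclic
    open GroupDeveloped K E (extension-order row) (extension-order column)
      -- The first `proj₁` is `χ`; the second is its congruence, equality in the extension being a
      -- pair of equalities.
      proj₁ proj₁ (expand K e M) (λ i j → K.∙-congˡ (entry _ _))

-- Distinctness of the rows of a generalized Hadamard matrix.

count-all : {A : Set a} {P : Pred A p} (P? : Decidable₁ P) {f : Vector A n} →
  (∀ i → P (f i)) → count P? (tabulate f) ≡ n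
count-all {n = ℕ.zero} P? all = ≡.refl
count-all {n = suc n} P? {f} all with P? (f zero)
... | yes _ = ≡.cong suc (count-all P? (all ∘ suc))
... | no ¬p = contradiction (all zero) ¬p

primePower>1 : IsPrimePower q → 1 ℕ.< q
primePower>1 (p , r , p-prime , r≢0 , ≡.refl) =
  ℕ.^-monoʳ-< p (ℕ.nonTrivial⇒n>1 p {{prime⇒nonTrivial p-prime}}) (ℕ.>-nonZero⁻¹ r {{r≢0}})

module _ (F : FiniteField q c ℓ₁ ℓ₂) (H : Matrix (FiniteField.Carrier F) v v) where
  open FiniteField F
  open AbelianGroupProperties +-abelianGroup using (x≈z//y)

  difference : ∀ {x y} α β → x + α ≈ y + β → x - y ≈ β - α
  difference {x} {y} α β eq = sym (x≈z//y (β - α) y x (trans (+-comm _ _)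
    (trans (sym (+-assoc y β (- α))) (sym (x≈z//y x α (y + β) eq)))))

  -- This makes the row and the constant of a codeword well defined, and it is the form in which the
  -- Hadamard property enters the arguments about the code.
  RowsDistinctModuloConstants : Set _
  RowsDistinctModuloConstants = ∀ i j α β → (∀ k → H i k + α ≈ H j k + β) → i ≡ j

  module _ (1<q : 1 ℕ.< q) (v≢0 : NonZero v) (gh : IsGH F H) where
    open IsGH gh

    -- A constant difference of rows would be taken v times instead of v/q.
    difference-nonconstant : ∀ {i j} → i Fin.< j → ∀ a → ¬ (∀ k → H i k - H j k ≈ a)
    difference-nonconstant i<j a constant = ℕ.<-irrefl
      (≡.trans (_∣_.equality q∣v) (≡.cong (ℕ._* q)
        (≡.trans (≡.sym (balanced i<j a)) (count-all (_≟ a) constant))))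
      (ℕ.m<m*n v q {{v≢0}} 1<q)

    rowsDistinct : RowsDistinctModuloConstants
    rowsDistinct i j α β eq with Fin.<-cmp i j
    ... | tri< i<j _ _ = contradiction (λ k → difference α β (eq k)) (difference-nonconstant i<j (β - α))
    ... | tri≈ _ i≡j _ = i≡j
    ... | tri> _ _ j<i = contradiction (λ k → difference β α (sym (eq k))) (difference-nonconstant j<i (α - β))

-- Change of coefficients for cocycles, and codewords as shifted rows.

mapCocycle : {G : Group g ℓg} {K : Group k ℓk} {L : Group a ℓ} → K ≅ L → Cocycle G K → Cocycle G L
mapCocycle {L = L} f ψ = record
  { ψ          = λ g h → F.to (⟨ g , h ⟩)
  ; ψ-cong     = λ g≈ h≈ → F.⟦⟧-cong (ψ-cong g≈ h≈)
  ; cocycle    = λ g h x → L.trans (L.sym (F.∙-homo _ _))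
      (L.trans (F.⟦⟧-cong (cocycle g h x)) (F.∙-homo _ _))
  ; normalizeˡ = λ g → L.trans (F.⟦⟧-cong (normalizeˡ g)) F.ε-homo
  ; normalizeʳ = λ g → L.trans (F.⟦⟧-cong (normalizeʳ g)) F.ε-homo
  }
  where
  open Cocycle ψ renaming (ψ to ⟨_,_⟩)
  module F = _≅_ f
  module L = Group L

-- Every codeword is uniquely H i + α 1; index and shift denote i and α.
module Code (F : FiniteField q c ℓ₁ ℓ₂) (H : Matrix (FiniteField.Carrier F) (suc v) (suc v))
  (distinct : RowsDistinctModuloConstants F H) where
  open FiniteField F hiding (zero)
  open AbelianGroupProperties +-abelianGroup
  open CommutativeSemigroupProperties (AbelianGroup.commutativeSemigroup +-abelianGroup)
    using (interchange)
  private
    infix 4 _≋′_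
    _≋′_ = _≋_ F {suc v}

  Codeword : Set _
  Codeword = ∃ (GHCode F H)

  word : Codeword → Vector Carrier (suc v)
  word = proj₁

  index : Codeword → Fin (suc v)
  index (_ , i , _) = i

  shift : Codeword → Carrier
  shift (_ , _ , α , _) = α

  word-≋ : ∀ x → word x ≋′ (λ k → H (index x) k + shift x)
  word-≋ (_ , _ , _ , x≋) = x≋

  codeword : Fin (suc v) → Carrier → Codeword
  codeword i α = (λ k → H i k + α) , i , α , λ _ → refl

  index-unique : ∀ x {i α} → word x ≋′ (λ k → H i k + α) → index x ≡ i
  index-unique x eq = distinct _ _ _ _ λ k → trans (sym (word-≋ x k)) (eq k)

  shift-unique : ∀ x {i α} → word x ≋′ (λ k → H i k + α) → shift x ≈ α
  -- Once the rows agree, one coordinate suffices to cancel them.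
  shift-unique x {i} eq with ≡.refl ← index-unique x eq =
    ∙-cancelˡ (H i zero) _ _ (trans (sym (word-≋ x zero)) (eq zero))

  index-cong : ∀ x y → word x ≋′ word y → index x ≡ index y
  index-cong x y x≋y = index-unique x λ k → trans (x≋y k) (word-≋ y k)

  shift-cong : ∀ x y → word x ≋′ word y → shift x ≈ shift y
  shift-cong x y x≋y = shift-unique x λ k → trans (x≋y k) (word-≋ y k)

  -- The constants are collected as `(β + α) + s`, the first component of a product in an extension
  -- whose cocycle takes the value `s`.
  regroup : ∀ {x y z s} α β → x + y ≈ z + s → (x + α) + (y + β) ≈ z + ((β + α) + s)
  regroup {x} {y} {z} {s} α β eq = begin
    (x + α) + (y + β)  ≈⟨ interchange x α y β ⟩
    (x + y) + (α + β)  ≈⟨ +-cong eq (+-comm α β) ⟩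
    (z + s) + (β + α)  ≈⟨ +-assoc z s (β + α) ⟩
    z + (s + (β + α))  ≈⟨ +-congˡ (+-comm s (β + α)) ⟩
    z + ((β + α) + s)  ∎
    where open SetoidReasoning setoid

  -- h_x ⋆ h_y is a shift of h_{yx}: the code is anti-isomorphic to the
  -- extension, with H i + α 1 corresponding to (φ α , row i).
  module _ {G : Group g ℓg} {K : Group k ℓk} (φ : +-group ≅ K)
    (comm : Commutative (Group._≈_ K) (Group._∙_ K))
    (f : Cocycle G +-group) (ψ : Cocycle G K)
    (φ∘f≈ψ : ∀ x y → Group._≈_ K (_≅_.to φ (Cocycle.ψ f x y)) (Cocycle.ψ ψ x y))
    (row : HasOrder G (suc v)) (P : FullPropelinear F (GHCode F H)) where
    private
      module G = Group G
      module K = Group K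
      module φ = _≅_ φ
      module Row = Inverse row
      open FullPropelinear P using (_⋆_; ⋆-group)

    ⋆-group≅extension :
      (∀ x y → word (x ⋆ y) ≋′ λ k →
        H (Row.from (Row.to (index y) G.∙ Row.to (index x))) k
          + ((shift y + shift x) + Cocycle.ψ f (Row.to (index y)) (Row.to (index x)))) →
      ⋆-group ≅ extension comm ψ
    ⋆-group≅extension product = ≅-fromAntiHomo ⋆-group (extension comm ψ)
      (λ x → φ.to (shift x) , Row.to (index x))
      (λ {x} {y} x≋y → φ.⟦⟧-cong (shift-cong x y x≋y) , Row.to-cong (index-cong x y x≋y))
      (λ x y →
          K.trans (φ.⟦⟧-cong (shift-unique (x ⋆ y) (product x y)))
            (K.trans (φ.∙-homo _ _) (K.∙-cong (φ.∙-homo _ _) (φ∘f≈ψ _ _)))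
        , Row.inverseˡ (index-unique (x ⋆ y) (product x y)))
      (λ {x} {y} (φα≈ , i≈) k → begin
        word x k                 ≈⟨ word-≋ x k ⟩
        H (index x) k + shift x
          ≈⟨ +-cong (reflexive (≡.cong (λ i → H i k) (row-injective i≈))) (φ.injective φα≈) ⟩
        H (index y) k + shift y  ≈⟨ word-≋ y k ⟨
        word y k                 ∎)
      (λ (u , x) → codeword (Row.from x) (proj₁ (φ.surjective u)) ,
        proj₂ (φ.surjective u) refl , Row.strictlyInverseˡ x)
      where
      open SetoidReasoning setoid
      row-injective : ∀ {i j} → Row.to i G.≈ Row.to j → i ≡ j
      row-injective {i} {j} i≈j = ≡.trans (≡.sym (Row.strictlyInverseʳ i)) (Row.inverseʳ i≈j)

  -- From a cocycle to a full propelinear structure.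

  module FromCocycle {G : Group g ℓg} (f : Cocycle G +-group) (cocyclic : IsCocyclic H f) where
    open Cocycle f renaming (ψ to ⟨_,_⟩)
    open IsCocyclic cocyclic
    private
      module G = Group G
      module Row = Inverse row
      module Column = Inverse column
      module G′ = GroupProperties G

    element : Codeword → G.Carrier
    element x = Row.to (index x)

    -- `permute` reads coordinates through the inverse permutation. The flip makes that inverse the
    -- left translation of column labels by `element x`.
    π : Codeword → Permutation′ (suc v)
    π x = Perm.flip (conjugate G.setoid column (leftTranslation G (element x)))

    π-cong′ : ∀ x y → element x G.≈ element y → π x Perm.≈ π y
    π-cong′ x y x≈y k = Column.from-cong (G.∙-congʳ (G.⁻¹-cong x≈y))

    -- This is the cocycle identity for the triple of the row label of `y`, the row label of `x` and
    -- a column label; the term free of the column label joins the shifts.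
    product : ∀ x y → (λ k → word x k + word y (π x ⟨$⟩ˡ k)) ≋′ λ k →
      H (Row.from (element y G.∙ element x)) k + ((shift y + shift x) + ⟨ element y , element x ⟩)
    product x y k = trans (+-cong (word-≋ x k) (word-≋ y _)) (regroup (shift x) (shift y) (begin
      H (index x) k + H (index y) (π x ⟨$⟩ˡ k)
        ≈⟨ +-cong (entry _ _) (trans (entry _ _) (ψ-cong G.refl (Column.strictlyInverseˡ _))) ⟩
      ⟨ gx , h ⟩ + ⟨ gy , gx G.∙ h ⟩   ≈⟨ +-comm _ _ ⟩
      ⟨ gy , gx G.∙ h ⟩ + ⟨ gx , h ⟩   ≈⟨ cocycle gy gx h ⟨
      ⟨ gy , gx ⟩ + ⟨ gy G.∙ gx , h ⟩  ≈⟨ +-comm _ _ ⟩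
      ⟨ gy G.∙ gx , h ⟩ + ⟨ gy , gx ⟩
        ≈⟨ +-congʳ (trans (entry _ _) (ψ-cong (Row.strictlyInverseˡ _) G.refl)) ⟨
      H (Row.from (gy G.∙ gx)) k + ⟨ gy , gx ⟩ ∎))
      where
      open SetoidReasoning setoid
      gx = element x
      gy = element y
      h = Column.to k

    identityRow : ∀ {i} → Row.to i G.≈ G.ε → ∀ k → H i k ≈ 0#
    identityRow i≈ε k = trans (entry _ _) (trans (ψ-cong i≈ε G.refl) (normalizeˡ _))

    identityRow′ : ∀ k → H (Row.from G.ε) k ≈ 0#
    identityRow′ = identityRow (Row.strictlyInverseˡ G.ε)

    constant : ∀ x → element x G.≈ G.ε → IsConstant F (word x)
    constant x x≈ε = shift x , λ k →
      trans (word-≋ x k) (trans (+-congʳ (identityRow x≈ε k)) (+-identityˡ _))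

    -- A constant word is a shift of the zero row, which is labelled by the identity, so uniqueness
    -- of the index applies.
    constant⁻¹ : ∀ x → IsConstant F (word x) → element x G.≈ G.ε
    constant⁻¹ x (α , x≋α) = Row.inverseˡ (index-unique x λ k →
      trans (x≋α k) (sym (trans (+-congʳ (identityRow′ k)) (+-identityˡ α))))

    fullPropelinear : FullPropelinear F (GHCode F H)
    fullPropelinear = record
      { 0∈C        = Row.from G.ε , 0# , λ k → sym (trans (+-identityʳ _) (identityRow′ k))
      ; π          = π
      ; π-cong     = λ x y x≋y → π-cong′ x y (Row.to-cong (index-cong x y x≋y))
      ; ⋆-closed   = closed
      ; ⋆-onto     = λ x z → solution x z , λ k → trans (product x (solution x z) k)
          (trans (+-cong (reflexive (≡.cong (λ i → H i k) (solution-index x z))) (solution-shift x z))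
            (sym (word-≋ z k)))
      ; π-homo     = λ x y k → Column.from-cong (begin
          element (_ , closed x y) G.⁻¹ G.∙ Column.to k
            ≈⟨ G.∙-congʳ (G.⁻¹-cong (Row.strictlyInverseˡ _)) ⟩
          (element y G.∙ element x) G.⁻¹ G.∙ Column.to k
            ≈⟨ G.∙-congʳ (G′.⁻¹-anti-homo-∙ _ _) ⟩
          (element x G.⁻¹ G.∙ element y G.⁻¹) G.∙ Column.to k
            ≈⟨ G.assoc _ _ _ ⟩
          element x G.⁻¹ G.∙ (element y G.⁻¹ G.∙ Column.to k)
            ≈⟨ G.∙-congˡ (Column.strictlyInverseˡ _) ⟨
          element x G.⁻¹ G.∙ Column.to (π y ⟨$⟩ʳ k) ∎)
      -- A fixed column label `h` satisfies `element x ⁻¹ ∙ h ≈ h`, which forces `element x` to be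
      -- the identity and `x` to be constant.
      ; π-free     = λ x ¬constant k fixed → ¬constant (constant x (G′.⁻¹-injective (G.trans
          (G′.identityˡ-unique _ (Column.to k)
            (G.trans (G.sym (Column.strictlyInverseˡ _)) (Column.to-cong fixed)))
          (G.sym G′.ε⁻¹≈ε))))
      ; π-constant = λ x const k → Column.inverseʳ (G.trans
          (G.∙-congʳ (G.trans (G.⁻¹-cong (constant⁻¹ x const)) G′.ε⁻¹≈ε)) (G.identityˡ _))
      }
      where
      open SetoidReasoning G.setoid

      closed : ∀ x y → (λ k → word x k + word y (π x ⟨$⟩ˡ k)) ∈ GHCode F H
      closed x y = _ , _ , product x y

      -- The formula `product` is solved for its second factor: first the row label, then the shift,
      -- which must offset both `shift x` and the cocycle value.
      solution : Codeword → Codeword → Codeword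
      solution x z = codeword i (shift z - (shift x + ⟨ Row.to i , element x ⟩))
        where i = Row.from (element z G.∙ element x G.⁻¹)

      solution-index : ∀ x z → Row.from (element (solution x z) G.∙ element x) ≡ index z
      solution-index x z = Row.inverseʳ
        (G.trans (G.∙-congʳ (Row.strictlyInverseˡ _)) (G′.//-rightDividesˡ _ _))

      solution-shift : ∀ x z →
        (shift (solution x z) + shift x) + ⟨ element (solution x z) , element x ⟩ ≈ shift z
      solution-shift x z = trans (+-assoc _ _ _) (//-rightDividesˡ _ _)

  -- From a full propelinear structure to a cocycle.

  module FromPropelinear (P : FullPropelinear F (GHCode F H))
    (firstRow : ∀ k → H zero k ≈ 0#) (firstColumn : ∀ i → H i zero ≈ 0#) where
    open FullPropelinear P using (π; π-cong; π-homo; π-free; π-constant; _⋆_; ⋆-onto; ⋆-group)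
    private
      module C = Group ⋆-group

    ρ : Fin (suc v) → Codeword
    ρ i = codeword i 0#

    origin : Fin (suc v) → Fin (suc v)
    origin i = π (ρ i) ⟨$⟩ˡ zero

    infixl 7 _·_
    -- The factors are reversed because in `ρ j ⋆ ρ i` it is row `i` that is permuted by `π (ρ j)`.
    -- The constant of this product is then the entry of row `i` at `origin j`, a cocycle value at
    -- `(i , j)` in this order.
    _·_ : Fin (suc v) → Fin (suc v) → Fin (suc v)
    i · j = index (ρ j ⋆ ρ i)

    ⟨_,_⟩ : Fin (suc v) → Fin (suc v) → Carrier
    ⟨ i , j ⟩ = H i (origin j)

    index-zero⇒constant : ∀ x → index x ≡ zero → IsConstant F (word x)
    index-zero⇒constant x i≡0 = shift x , λ k → trans (word-≋ x k)
      (trans (+-congʳ (trans (reflexive (≡.cong (λ i → H i k) i≡0)) (firstRow k))) (+-identityˡ _))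

    constant⇒index-zero : ∀ x → IsConstant F (word x) → index x ≡ zero
    constant⇒index-zero x (α , x≋α) = index-unique x λ k →
      trans (x≋α k) (sym (trans (+-congʳ (firstRow k)) (+-identityˡ α)))

    -- A codeword is the `⋆`-product of a constant word and its row, and constant words have the
    -- identity permutation.
    π-index : ∀ x {i} → index x ≡ i → π x Perm.≈ π (ρ i)
    π-index x ≡.refl k = ≡.trans (π-cong x (κ ⋆ ρ (index x)) x≋ k)
      (≡.trans (π-homo κ (ρ (index x)) k) (π-constant κ κ-constant _))
      where
      κ : Codeword
      κ = codeword zero (shift x)
      κ-constant : IsConstant F (word κ)
      κ-constant = index-zero⇒constant κ ≡.refl
      x≋ : word x ≋′ word (κ ⋆ ρ (index x))
      x≋ k = begin
        word x k                  ≈⟨ word-≋ x k ⟩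
        H (index x) k + shift x   ≈⟨ +-comm _ _ ⟩
        shift x + H (index x) k
          ≈⟨ +-cong (trans (+-congʳ (firstRow k)) (+-identityˡ _))
                    (trans (+-identityʳ _) (reflexive (≡.cong (H (index x))
                      (≈⇒≡ˡ (π κ) Perm.id (π-constant κ κ-constant) k)))) ⟨
        word (κ ⋆ ρ (index x)) k  ∎
        where open SetoidReasoning setoid

    -- The constant is found at the first coordinate, where every row of `H` vanishes.
    product : ∀ i j k → H j k + H i (π (ρ j) ⟨$⟩ˡ k) ≈ H (i · j) k + ⟨ i , j ⟩
    product i j k = trans (ρ⋆ρ k) (+-congˡ (begin
      shift (ρ j ⋆ ρ i)                     ≈⟨ +-identityˡ _ ⟨
      0# + shift (ρ j ⋆ ρ i)                ≈⟨ +-congʳ (firstColumn _) ⟨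
      H (i · j) zero + shift (ρ j ⋆ ρ i)    ≈⟨ ρ⋆ρ zero ⟨
      H j zero + H i (origin j)             ≈⟨ +-congʳ (firstColumn _) ⟩
      0# + H i (origin j)                   ≈⟨ +-identityˡ _ ⟩
      ⟨ i , j ⟩                             ∎))
      where
      open SetoidReasoning setoid
      ρ⋆ρ : ∀ k → H j k + H i (π (ρ j) ⟨$⟩ˡ k) ≈ H (i · j) k + shift (ρ j ⋆ ρ i)
      ρ⋆ρ k = trans (sym (+-cong (+-identityʳ _) (+-identityʳ _))) (word-≋ (ρ j ⋆ ρ i) k)

    ⋆-product : ∀ x y → word (x ⋆ y) ≋′ λ k →
      H (index y · index x) k + ((shift y + shift x) + ⟨ index y , index x ⟩)
    ⋆-product x y k = trans (+-cong (word-≋ x k) (word-≋ y _)) (regroup (shift x) (shift y)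
      (trans (+-congˡ (reflexive (≡.cong (H (index y))
          (≈⇒≡ˡ (π x) (π (ρ (index x))) (π-index x ≡.refl) k))))
        (product (index y) (index x) k)))

    -- Since `index` reverses products on the whole code, the group laws of `_·_` follow from those
    -- of `_⋆_`.
    index-⋆ : ∀ x y → index (x ⋆ y) ≡ index y · index x
    index-⋆ x y = index-unique (x ⋆ y) (⋆-product x y)

    index-ε : index C.ε ≡ zero
    index-ε = constant⇒index-zero C.ε (0# , λ _ → refl)

    ·-assoc : ∀ i j k → (i · j) · k ≡ i · (j · k)
    ·-assoc i j k = begin
      (i · j) · k                  ≡⟨ index-⋆ (ρ k) (ρ j ⋆ ρ i) ⟨
      index (ρ k ⋆ (ρ j ⋆ ρ i))
        ≡⟨ index-cong ((ρ k ⋆ ρ j) ⋆ ρ i) (ρ k ⋆ (ρ j ⋆ ρ i)) (C.assoc (ρ k) (ρ j) (ρ i)) ⟨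
      index ((ρ k ⋆ ρ j) ⋆ ρ i)    ≡⟨ index-⋆ (ρ k ⋆ ρ j) (ρ i) ⟩
      i · (j · k)                  ∎
      where open ≡.≡-Reasoning

    ·-identityˡ : ∀ i → zero · i ≡ i
    ·-identityˡ i = begin
      zero · i               ≡⟨ ≡.cong (_· i) index-ε ⟨
      index C.ε · i          ≡⟨ index-⋆ (ρ i) C.ε ⟨
      index (ρ i ⋆ C.ε)      ≡⟨ index-cong (ρ i ⋆ C.ε) (ρ i) (C.identityʳ (ρ i)) ⟩
      i                      ∎
      where open ≡.≡-Reasoning

    ·-identityʳ : ∀ i → i · zero ≡ i
    ·-identityʳ i = begin
      i · zero               ≡⟨ ≡.cong (i ·_) index-ε ⟨
      i · index C.ε          ≡⟨ index-⋆ C.ε (ρ i) ⟨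
      index (C.ε ⋆ ρ i)      ≡⟨ index-cong (C.ε ⋆ ρ i) (ρ i) (C.identityˡ (ρ i)) ⟩
      i                      ∎
      where open ≡.≡-Reasoning

    _⁻ : Fin (suc v) → Fin (suc v)
    i ⁻ = index (ρ i C.⁻¹)

    ·-inverseˡ : ∀ i → i ⁻ · i ≡ zero
    ·-inverseˡ i = ≡.trans (≡.sym (index-⋆ (ρ i) (ρ i C.⁻¹)))
      (≡.trans (index-cong (ρ i ⋆ ρ i C.⁻¹) C.ε (C.inverseʳ (ρ i))) index-ε)

    ·-inverseʳ : ∀ i → i · i ⁻ ≡ zero
    ·-inverseʳ i = ≡.trans (≡.sym (index-⋆ (ρ i C.⁻¹) (ρ i)))
      (≡.trans (index-cong (ρ i C.⁻¹ ⋆ ρ i) C.ε (C.inverseˡ (ρ i))) index-ε)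

    -- The quotient of the code by the constants, with reversed product.
    G : Group 0ℓ 0ℓ
    G = record
      { Carrier = Fin (suc v)
      ; _≈_     = _≡_
      ; _∙_     = _·_
      ; ε       = zero
      ; _⁻¹     = _⁻
      ; isGroup = record
        { isMonoid = record
          { isSemigroup = record
            { isMagma = record { isEquivalence = ≡.isEquivalence ; ∙-cong = ≡.cong₂ _·_ }
            ; assoc   = ·-assoc
            }
          ; identity = ·-identityˡ , ·-identityʳ
          }
        ; inverse = ·-inverseˡ , ·-inverseʳ
        ; ⁻¹-cong = ≡.cong _⁻
        }
      }

    -- The row of `i · j` differs from `ρ j ⋆ ρ i` by a constant, so both have the same permutation,
    -- and inverting a composite reverses it.
    origin-· : ∀ i j → origin (i · j) ≡ π (ρ i) ⟨$⟩ˡ origin j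
    origin-· i j = ≡.trans
      (≡.sym (≈⇒≡ˡ (π (ρ j ⋆ ρ i)) (π (ρ (i · j))) (π-index (ρ j ⋆ ρ i) ≡.refl) zero))
      (≈⇒≡ˡ (π (ρ j ⋆ ρ i)) (π (ρ i) ∘ₚ π (ρ j)) (π-homo (ρ j) (ρ i)) zero)

    f : Cocycle G +-group
    f = record
      { ψ          = ⟨_,_⟩
      ; ψ-cong     = λ { ≡.refl ≡.refl → refl }
      -- The identity is `product i j` read at the coordinate `origin k`.
      ; cocycle    = λ i j k → begin
          ⟨ i , j ⟩ + ⟨ i · j , k ⟩                           ≈⟨ +-comm _ _ ⟩
          ⟨ i · j , k ⟩ + ⟨ i , j ⟩                           ≈⟨ product i j (origin k) ⟨
          ⟨ j , k ⟩ + H i (π (ρ j) ⟨$⟩ˡ origin k)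
            ≈⟨ +-congˡ (reflexive (≡.cong (H i) (origin-· j k))) ⟨
          ⟨ j , k ⟩ + ⟨ i , j · k ⟩                           ≈⟨ +-comm _ _ ⟩
          ⟨ i , j · k ⟩ + ⟨ j , k ⟩                           ∎
      ; normalizeˡ = λ i → firstRow (origin i)
      -- The word `ρ zero` is constant, so `origin zero` is the first coordinate.
      ; normalizeʳ = λ i → trans
          (reflexive (≡.cong (H i) (≈⇒≡ˡ (π (ρ zero)) Perm.id
            (π-constant (ρ zero) (index-zero⇒constant (ρ zero) ≡.refl)) zero)))
          (firstColumn i)
      }
      where open SetoidReasoning setoid

    -- Decidable equality of indices allows `π-free` to be used in contrapositive form.
    π-fixed⇒index-zero : ∀ x k → π x ⟨$⟩ˡ k ≡ k → index x ≡ zero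
    π-fixed⇒index-zero x k fixed with index x Fin.≟ zero
    ... | yes i≡0 = i≡0
    ... | no  i≢0 = contradiction
      (≡.trans (≡.cong (π x ⟨$⟩ʳ_) (≡.sym fixed)) (Perm.inverseʳ (π x)))
      (π-free x (i≢0 ∘ constant⇒index-zero x) k)

    -- If h_j = h_i ⋆ y and origin i = origin j, then π_y fixes that
    -- coordinate, so y is constant.
    origin-injective : Injective _≡_ _≡_ origin
    origin-injective {i} {j} eq = begin
      i                ≡⟨ ·-identityˡ i ⟨
      zero · i         ≡⟨ ≡.cong (_· i) (π-fixed⇒index-zero y (origin i) y-fixes) ⟨
      index y · i      ≡⟨ index-⋆ (ρ i) y ⟨
      index (ρ i ⋆ y)  ≡⟨ index-cong (ρ i ⋆ y) (ρ j) y-solves ⟩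
      j                ∎
      where
      open ≡.≡-Reasoning
      y = proj₁ (⋆-onto (ρ i) (ρ j))
      y-solves = proj₂ (⋆-onto (ρ i) (ρ j))
      y-fixes : π y ⟨$⟩ˡ origin i ≡ origin i
      y-fixes = begin
        π y ⟨$⟩ˡ origin i     ≡⟨ ≈⇒≡ˡ (π (ρ i ⋆ y)) (π y ∘ₚ π (ρ i)) (π-homo (ρ i) y) zero ⟨
        π (ρ i ⋆ y) ⟨$⟩ˡ zero ≡⟨ ≈⇒≡ˡ (π (ρ i ⋆ y)) (π (ρ j)) (π-cong (ρ i ⋆ y) (ρ j) y-solves) zero ⟩
        origin j              ≡⟨ eq ⟨
        origin i              ∎

    originPermutation : Permutation′ (suc v)
    originPermutation = injective⇒permutation origin origin-injective

    cocyclic : IsCocyclic H f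
    cocyclic = record
      { row    = Perm.id
      -- Column `k` gets as label the row `i` with `origin i ≡ k`.
      ; column = Perm.flip originPermutation
      ; entry  = λ i j → reflexive (≡.cong (H i) (≡.sym (Perm.inverseʳ originPermutation)))
      }

-- Both directions, carried between the field and `K` by `φ`.

corollary3p5 : ∀ {c ℓ₁ ℓ₂ k ℓk g ℓg : Level} {q v : ℕ} →
    IsPrimePower q → NonZero v →
    (F : FiniteField q c ℓ₁ ℓ₂) →
    (H : Matrix (FiniteField.Carrier F) v v) → IsGH F H → IsNormalized F H →
    (K : Group k ℓk) (φ : FiniteField.+-group F ≅ K) (e : Enumeration K q) →
    let φ[H] = map (_≅_.to φ) H
        Aut  = PAut K (expand K e φ[H])
        comm = ≅-comm (FiniteField.+-abelianGroup F) K φ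
    in
    ((P : FullPropelinear F (GHCode F H)) →
      Σ[ G ∈ Group 0ℓ 0ℓ ] HasOrder G v ×
      (Σ[ ψ ∈ Cocycle G K ] IsCocyclic φ[H] ψ ×
      (Σ[ R ∈ Subgroup Aut 0ℓ ] IsRegular K R ×
        extension comm ψ ≅ Subgroup.group R ×
        Subgroup.group R ≅ FullPropelinear.⋆-group P)))
    ×
    ((G : Group g ℓg) (ψ : Cocycle G K) → IsCocyclic φ[H] ψ →
      Σ[ P ∈ FullPropelinear F (GHCode F H) ]
      Σ[ R ∈ Subgroup Aut 0ℓ ] IsRegular K R ×
        FullPropelinear.⋆-group P ≅ extension comm ψ ×
        extension comm ψ ≅ Subgroup.group R)
-- The order is nonzero by `v≢0`, which provides a first row and a first column.
corollary3p5 {v = suc v} primePower v≢0 F H gh normalized K φ e = cocyclicFromCode , codeFromCocyclic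
  where
  open FiniteField F using (+-group; +-abelianGroup)
  open IsNormalized normalized
  open Code F H (rowsDistinct F H (primePower>1 primePower) v≢0 gh)
  module K = Group K
  module φ = _≅_ φ

  comm : Commutative K._≈_ K._∙_
  comm = ≅-comm +-abelianGroup K φ

  φ[H] : Matrix K.Carrier (suc v) (suc v)
  φ[H] = map φ.to H

  cocyclicFromCode : (P : FullPropelinear F (GHCode F H)) →
    Σ[ G ∈ Group 0ℓ 0ℓ ] HasOrder G (suc v) ×
    (Σ[ ψ ∈ Cocycle G K ] IsCocyclic φ[H] ψ ×
    (Σ[ R ∈ Subgroup (PAut K (expand K e φ[H])) 0ℓ ] IsRegular K R ×
      extension comm ψ ≅ Subgroup.group R ×
      Subgroup.group R ≅ FullPropelinear.⋆-group P))
  cocyclicFromCode P =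
    let R , regular , E≅R = regularSubgroup comm ψ e φ-cocyclic in
    G , Perm.id , ψ , φ-cocyclic , R , regular , E≅R ,
    ≅-trans (≅-sym E≅R) (≅-sym (⋆-group≅extension φ comm f ψ (λ _ _ → K.refl) Perm.id P ⋆-product))
    where
    open FromPropelinear P (λ k → firstRow zero k ≡.refl) (λ i → firstColumn i zero ≡.refl)
    ψ : Cocycle G K
    ψ = mapCocycle φ f
    φ-cocyclic : IsCocyclic φ[H] ψ
    φ-cocyclic = record
      { row    = IsCocyclic.row cocyclic
      ; column = IsCocyclic.column cocyclic
      ; entry  = λ i j → φ.⟦⟧-cong (IsCocyclic.entry cocyclic i j)
      }

  codeFromCocyclic : (G : Group _ _) (ψ : Cocycle G K) → IsCocyclic φ[H] ψ →
    Σ[ P ∈ FullPropelinear F (GHCode F H) ]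
    Σ[ R ∈ Subgroup (PAut K (expand K e φ[H])) 0ℓ ] IsRegular K R ×
      FullPropelinear.⋆-group P ≅ extension comm ψ ×
      extension comm ψ ≅ Subgroup.group R
  codeFromCocyclic G ψ φ-cocyclic =
    let R , regular , E≅R = regularSubgroup comm ψ e φ-cocyclic in
    fullPropelinear , R , regular ,
    ⋆-group≅extension φ comm f ψ φ∘f≈ψ row fullPropelinear product , E≅R
    where
    open IsCocyclic φ-cocyclic
    -- Codewords are added in the field, so the cocycle is pulled back along `φ`; applying `φ`
    -- recovers `ψ`.
    f : Cocycle G +-group
    f = mapCocycle (≅-sym φ) ψ
    φ∘f≈ψ : ∀ x y → φ.to (Cocycle.ψ f x y) K.≈ Cocycle.ψ ψ x y
    φ∘f≈ψ x y = proj₂ (φ.surjective (Cocycle.ψ ψ x y)) (FiniteField.refl F)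
    cocyclic : IsCocyclic H f
    cocyclic = record
      { row    = row
      ; column = column
      ; entry  = λ i j → φ.injective (K.trans (entry i j) (K.sym (φ∘f≈ψ _ _)))
      }
    open FromCocycle f cocyclic
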